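{- Let $\mathcal{C}\subseteq\mathbb{F}^n$ be a $k$-dimensional $\mathbb{F}$-linear sum-rank metric code and $M_{\mathcal{C}}=(\mathbf{K}^{\mathbf{n}},\rho_{\mathcal{C}})$ its associated sum-matroid. Then for $i=1,\dots,k$, $d^S_i(M_{\mathcal{C}})=d_{SR,i}(\mathcal{C})$.
   Context: Let $\ell,n_1,\dots,n_\ell$ be positive integers, $n=\sum n_i$, $K_1,\dots,K_\ell$ finite fields with common finite extension $\mathbb{F}$, $[\mathbb{F}:K_i]=m_i$. Write $\mathbf{c}\in\mathbb{F}^n$ as $(\mathbf{c}^{(1)},\dots,\mathbf{c}^{(\ell)})$, $\mathbf{c}^{(i)}\in\mathbb{F}^{n_i}$; with a fixed ordered basis $\Gamma_i$ of $\mathbb{F}/K_i$, $\Gamma_i(\mathbf{c}^{(i)})$ is the $m_i\times n_i$ matrix over $K_i$ whose $j$-th column is the coordinate vector of the $j$-th entry of $\mathbf{c}^{(i)}$, and $\mathrm{supp}(\mathbf{c})$ is the tuple of the $K_i$-row spaces of $\Gamma_i(\mathbf{c}^{(i)})$. $\mathcal{P}(\mathbf{K}^{\mathbf{n}})$ is the set of tuples $\mathcal{L}=(\mathcal{L}_1,\dots,\mathcal{L}_\ell)$ of $K_i$-subspaces of $K_i^{n_i}$ with componentwise inclusion, $\mathbf{K}^{\mathbf{n}}=(K_1^{n_1},\dots,K_\ell^{n_\ell})$, $\mathrm{Rk}(\mathcal{L})=\sum\dim_{K_i}\mathcal{L}_i$. $\mathcal{V}_{\mathcal{L}}=\{\mathbf{c}\in\mathbb{F}^n:\mathrm{supp}(\mathbf{c})\subseteq\mathcal{L}\}$,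 and $d_{SR,i}(\mathcal{C})=\min\{\mathrm{Rk}(\mathcal{L}):\dim_{\mathbb{F}}(\mathcal{C}\cap\mathcal{V}_{\mathcal{L}})\ge i\}$. The associated sum-matroid: for $\mathcal{L}$ with $\dim_{K_i}\mathcal{L}_i=N_i$, $N=\sum N_i$, let $\mathbf{A}_i\in K_i^{N_i\times n_i}$ have rows forming a basis of $\mathcal{L}_i$, $\mathbf{A}=\mathrm{diag}(\mathbf{A}_1,\dots,\mathbf{A}_\ell)$, $\Pi_{\mathcal{L}}(\mathbf{x})=\mathbf{x}\mathbf{A}^T$ ($\mathbb{F}^n\to\mathbb{F}^N$), and $\rho_{\mathcal{C}}(\mathcal{L})=\dim_{\mathbb{F}}\Pi_{\mathcal{L}}(\mathcal{C}^\perp)$, where $\mathcal{C}^\perp$ is the dual code for the standard dot product. For a sum-matroid $M=(\mathbf{K}^{\mathbf{n}},\rho)$, the nullity is $\eta(\mathcal{L})=\mathrm{Rk}(\mathcal{L})-\rho(\mathcal{L})$ and the $i$-th generalized weight is $d^S_i(M)=\min\{\mathrm{Rk}(\mathcal{L}):\mathcal{L}\in\mathcal{P}(\mathbf{K}^{\mathbf{n}}),\ \eta(\mathcal{L})=i\}$ for $i=1,\dots,\eta(\mathbf{K}^{\mathbf{n}})$. -}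

module Defs where

open import Level using (0ℓ)
open import Data.Nat using (ℕ; zero; suc; _≤_; _∸_) renaming (_+_ to _+ℕ_)
open import Data.Fin using (Fin; zero; suc)
open import Data.Product using (Σ; ∃; ∃-syntax; _×_; _,_)
open import Data.Unit using (⊤; tt)
open import Data.List using (List)
open import Data.List.Membership.Propositional using (_∈_)
open import Relation.Nullary using (¬_)
open import Relation.Binary.PropositionalEquality using (_≡_; _≗_)
open import Relation.Binary.Definitions using (DecidableEquality)
open import Algebra.Structures using (IsCommutativeRing)

record FiniteField : Set₁ where
  infixl 6 _+_
  infixl 7 _*_
  field
    Carrier : Set
    _+_ _*_ : Carrier → Carrier → Carrier
    -_      : Carrier → Carrier
    0# 1#   : Carrier
    isCommutativeRing : IsCommutativeRing _≡_ _+_ _*_ -_ 0# 1#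
    0≢1     : ¬ (0# ≡ 1#)
    inverse : ∀ x → ¬ (x ≡ 0#) → ∃[ y ] (x * y ≡ 1#)
    _≟_     : DecidableEquality Carrier
    elements : List Carrier
    complete : ∀ x → x ∈ elements

Σℕ : ∀ n → (Fin n → ℕ) → ℕ
Σℕ zero    f = 0
Σℕ (suc n) f = f zero +ℕ Σℕ n (λ j → f (suc j))

IsMin : (ℕ → Set) → ℕ → Set
IsMin P m = P m × (∀ r → P r → m ≤ r)

-- Linear algebra over a finite field F, with scalars restricted to a
-- subset S ⊆ F (S = a subfield K, or S = everything for F itself).
-- Vectors are functions I → F for an index type I.

module LinAlg (𝔽 : FiniteField) where
  open FiniteField 𝔽 public

  record IsSubfield (K : Carrier → Set) : Set where
    field
      0∈ : K 0#
      1∈ : K 1#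
      +∈ : ∀ {x y} → K x → K y → K (x + y)
      *∈ : ∀ {x y} → K x → K y → K (x * y)
      -∈ : ∀ {x} → K x → K (- x)
      ⁻¹∈ : ∀ {x y} → K x → x * y ≡ 1# → K y

  AllF : Carrier → Set
  AllF _ = ⊤

  sumF : ∀ n → (Fin n → Carrier) → Carrier
  sumF zero    f = 0#
  sumF (suc n) f = f zero + sumF n (λ j → f (suc j))

  0v : {I : Set} → I → Carrier
  0v _ = 0#

  lincomb : {I : Set} (d : ℕ) → (Fin d → Carrier) → (Fin d → I → Carrier) → I → Carrier
  lincomb d c v ι = sumF d (λ t → c t * v t ι)

  InSpan : {I : Set} (S : Carrier → Set) {d : ℕ} → (Fin d → I → Carrier) → (I → Carrier) → Set
  InSpan S {d} v x = ∃[ c ] ((∀ t → S (c t)) × (x ≗ lincomb d c v))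

  Independent : {I : Set} (S : Carrier → Set) {d : ℕ} → (Fin d → I → Carrier) → Set
  Independent S {d} v = ∀ c → (∀ t → S (c t)) → lincomb d c v ≗ 0v → ∀ t → c t ≡ 0#

  IsBasis : {I : Set} (S : Carrier → Set) → ((I → Carrier) → Set) → {d : ℕ} → (Fin d → I → Carrier) → Set
  IsBasis S V v = (∀ t → V (v t)) × Independent S v × (∀ x → V x → InSpan S v x)

  HasDim : {I : Set} (S : Carrier → Set) → ((I → Carrier) → Set) → ℕ → Set
  HasDim {I} S V d = Σ (Fin d → I → Carrier) (λ v → IsBasis S V v)

-- The sum-rank setting.
--   ℓ blocks, block lengths ns i, subfields Ks i of F,
--   γ i an ordered basis (of length ms i) of F over Ks i.

module SumRank (𝔽 : FiniteField) (ℓ : ℕ) (ns : Fin ℓ → ℕ)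
               (Ks : Fin ℓ → FiniteField.Carrier 𝔽 → Set)
               (ms : Fin ℓ → ℕ)
               (γ : (i : Fin ℓ) → Fin (ms i) → FiniteField.Carrier 𝔽) where
  open LinAlg 𝔽 public

  -- index set of F^n written blockwise, n = Σ ns i
  BI : (Fin ℓ → ℕ) → Set
  BI ms' = Σ (Fin ℓ) (λ i → Fin (ms' i))

  Vn : Set
  Vn = BI ns → Carrier

  dot : Vn → Vn → Carrier
  dot x y = sumF ℓ (λ i → sumF (ns i) (λ j → x (i , j) * y (i , j)))

  -- An element 𝓛 of P(K^n): for each i, a K_i-subspace of K_i^{n_i},
  -- given by a matrix A_i whose N_i rows form a K_i-basis of it.
  record SubTuple : Set where
    field
      N      : Fin ℓ → ℕ
      A      : (i : Fin ℓ) → Fin (N i) → Fin (ns i) → Carrier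
      A∈K    : ∀ i t j → Ks i (A i t j)
      A-indep : ∀ i → Independent (Ks i) (A i)
  open SubTuple public

  Comp : (𝓛 : SubTuple) (i : Fin ℓ) → (Fin (ns i) → Carrier) → Set
  Comp 𝓛 i x = (∀ j → Ks i (x j)) × InSpan (Ks i) (A 𝓛 i)  x

  Rk : SubTuple → ℕ
  Rk 𝓛 = Σℕ ℓ (N 𝓛)

  -- a is the coordinate matrix Γ_i(c^(i)) (m_i × n_i over K_i):
  -- column j holds the coordinates of c^(i)_j in the basis γ i.
  IsCoordMatrix : (i : Fin ℓ) → (Fin (ns i) → Carrier) → (Fin (ms i) → Fin (ns i) → Carrier) → Set
  IsCoordMatrix i ci a = (∀ r j → Ks i (a r j)) × (∀ j → ci j ≡ sumF (ms i) (λ r → a r j * γ i r))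

  -- supp(c) ⊆ 𝓛 : for every i, the row space of Γ_i(c^(i)) is contained in 𝓛_i
  SuppIn : Vn → SubTuple → Set
  SuppIn c 𝓛 = ∀ i → Σ (Fin (ms i) → Fin (ns i) → Carrier)
                       (λ a → IsCoordMatrix i (λ j → c (i , j)) a × (∀ r → Comp 𝓛 i (a r)))

  V : SubTuple → Vn → Set
  V 𝓛 c = SuppIn c 𝓛

  Π : (𝓛 : SubTuple) → Vn → BI (N 𝓛) → Carrier
  Π 𝓛 x (i , t) = sumF (ns i) (λ j → x (i , j) * A 𝓛 i t j)

  -- Codes: a code 𝒞 ⊆ F^n is an F-subspace (a predicate on Vn).

  module Code (𝒞 : Vn → Set) where

    Dual : Vn → Set
    Dual x = ∀ c → 𝒞 c → dot x c ≡ 0#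

    ρ : SubTuple → ℕ → Set
    ρ 𝓛 r = HasDim AllF (λ y → ∃[ x ] (Dual x × (y ≗ Π 𝓛 x))) r

    dSR : ℕ → ℕ → Set
    dSR i = IsMin (λ r → ∃[ 𝓛 ] (Rk 𝓛 ≡ r × ∃[ d ] (HasDim AllF (λ c → 𝒞 c × V 𝓛 c) d × i ≤ d)))

  Nullity : (SubTuple → ℕ → Set) → SubTuple → ℕ → Set
  Nullity ρ 𝓛 i = ∃[ r ] (ρ 𝓛 r × Rk 𝓛 ∸ r ≡ i)

  dS : (SubTuple → ℕ → Set) → ℕ → ℕ → Set
  dS ρ i = IsMin (λ r → ∃[ 𝓛 ] (Nullity ρ 𝓛 i × Rk 𝓛 ≡ r))

{-# OPTIONS --safe #-}

-- For a tuple 𝓛 with row matrix A, the map u ↦ uA is injective over 𝔽 and has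
-- image V_𝓛.  It is adjoint to Π_𝓛, so uA ∈ 𝒞 = 𝒞^⊥⊥ iff u is orthogonal to
-- Π_𝓛(𝒞^⊥); hence dim (𝒞 ∩ V_𝓛) = Rk 𝓛 − ρ(𝓛) = η(𝓛).  Deleting one row of A
-- lowers η by at most one, so an 𝓛 of least rank among those with η(𝓛) ≥ i has
-- η(𝓛) = i, and both minima coincide.  Such an 𝓛 exists constructively because
-- there are finitely many matrices over 𝔽 and membership in K_i is decidable.
module Submission where

open import Defs
open import Level using (0ℓ)
open import Algebra.Bundles using (CommutativeRing)
open import Data.Nat as ℕ using (ℕ; zero; suc; _≤_; z≤n; s≤s)
import Data.Nat.Properties as ℕ
open import Data.Fin using (Fin; zero; suc; punchIn; splitAt; _↑ˡ_; _↑ʳ_)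
open import Data.Fin.Properties using (any?; all?; ∀-cons; splitAt-↑ˡ; splitAt-↑ʳ; splitAt⁻¹-↑ˡ; splitAt⁻¹-↑ʳ)
open import Data.List.Membership.Propositional using (find; lose)
open import Data.List.Relation.Unary.Any using () renaming (any? to anyElement?)
open import Data.Product using (Σ; ∃-syntax; _×_; _,_; proj₁; proj₂)
open import Data.Sum using (_⊎_; inj₁; inj₂; [_,_]′)
open import Data.Unit using (⊤; tt)
open import Data.Vec.Functional using (_∷_; tail; insertAt)
open import Data.Vec.Functional.Properties using (insertAt-lookup; insertAt-punchIn)
open import Function using (_∘_; id)
open import Relation.Nullary using (¬_; Dec; yes; no; contradiction)
open import Relation.Nullary.Decidable using (¬?; decidable-stable; _×-dec_; map′)
open import Relation.Binary.PropositionalEquality using (_≡_; _≗_; refl; sym; trans; cong; cong₂; subst; subst₂; module ≡-Reasoning)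

-- The dimensions in `dS` and `dSR` are existential relations, so neither minimum can be searched
-- for as it stands. Gaussian elimination turns both dimensions into computed numbers. Applied to a
-- basis of 𝒞^⊥ projected along A, one run yields a basis of Π_𝓛(𝒞^⊥), of size `rank`, and a basis
-- of its orthogonal complement, of size `null`; the latter is carried by u ↦ uA to a basis of 𝒞 ∩
-- V_𝓛. The dimension formula is then the field `rank+null`. The exchange inequality compares these
-- sizes with those of arbitrary bases, so one decidable predicate, `Attains`, controls both minima,
-- and the theorem exhibits a single number that is at once both weights.

-- Block indices and sums of natural numbers

Blocks : ∀ ℓ → (Fin ℓ → ℕ) → Set
Blocks ℓ N = Σ (Fin ℓ) (λ i → Fin (N i))

flatten : ∀ ℓ (N : Fin ℓ → ℕ) → Blocks ℓ N → Fin (Σℕ ℓ N)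
flatten (suc ℓ) N (zero  , j) = j ↑ˡ _
flatten (suc ℓ) N (suc i , j) = N zero ↑ʳ flatten ℓ (N ∘ suc) (i , j)

shift : ∀ {ℓ} {N : Fin (suc ℓ) → ℕ} → Blocks ℓ (N ∘ suc) → Blocks (suc ℓ) N
shift (i , j) = suc i , j

unflatten : ∀ ℓ (N : Fin ℓ → ℕ) → Fin (Σℕ ℓ N) → Blocks ℓ N
unflatten (suc ℓ) N x = [ zero ,_ , shift ∘ unflatten ℓ (N ∘ suc) ]′ (splitAt (N zero) x)

unflatten-flatten : ∀ ℓ (N : Fin ℓ → ℕ) ι → unflatten ℓ N (flatten ℓ N ι) ≡ ι
unflatten-flatten (suc ℓ) N (zero , j)
  rewrite splitAt-↑ˡ (N zero) j (Σℕ ℓ (N ∘ suc)) = refl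
unflatten-flatten (suc ℓ) N (suc i , j)
  rewrite splitAt-↑ʳ (N zero) (Σℕ ℓ (N ∘ suc)) (flatten ℓ (N ∘ suc) (i , j)) =
  cong shift (unflatten-flatten ℓ (N ∘ suc) (i , j))

flatten-unflatten : ∀ ℓ (N : Fin ℓ → ℕ) x → flatten ℓ N (unflatten ℓ N x) ≡ x
flatten-unflatten (suc ℓ) N x with splitAt (N zero) x in eq
... | inj₁ j = splitAt⁻¹-↑ˡ eq
... | inj₂ y = trans (cong (N zero ↑ʳ_) (flatten-unflatten ℓ (N ∘ suc) y)) (splitAt⁻¹-↑ʳ eq)

Σℕ-cong : ∀ n {f g : Fin n → ℕ} → f ≗ g → Σℕ n f ≡ Σℕ n g
Σℕ-cong zero    f≗g = refl
Σℕ-cong (suc n) f≗g = cong₂ ℕ._+_ (f≗g zero) (Σℕ-cong n (f≗g ∘ suc))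

≤Σℕ : ∀ {n} (f : Fin n → ℕ) i → f i ≤ Σℕ n f
≤Σℕ f zero    = ℕ.m≤m+n _ _
≤Σℕ f (suc i) = ℕ.≤-trans (≤Σℕ (f ∘ suc) i) (ℕ.m≤n+m _ (f zero))

-- Chooses the block that will lose a row: the first one of positive size. The disjunction records,
-- block by block, whether all rows are kept or one is removed.
Σℕ-decrement : ∀ n (f : Fin n → ℕ) {m} → Σℕ n f ≡ suc m →
  ∃[ g ] (Σℕ n g ≡ m × (∀ i → f i ≡ g i ⊎ f i ≡ suc (g i)))
Σℕ-decrement (suc n) f eq with f zero in f₀
... | zero  = let (g , Σg≡m , f-g) = Σℕ-decrement n (f ∘ suc) eq in
  (0 ∷ g) , Σg≡m , λ { zero → inj₁ f₀ ; (suc i) → f-g i }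
... | suc a = (a ∷ (f ∘ suc)) , ℕ.suc-injective eq , λ { zero → inj₂ f₀ ; (suc i) → inj₁ refl }

-- Least witnesses and exhaustive search

least : ∀ {P : ℕ → Set} → (∀ r → Dec (P r)) → ∀ n → P n → ∃[ m ] IsMin P m
least P? n Pn with P? 0
... | yes P0 = 0 , P0 , λ _ _ → z≤n
least P? zero    P0 | no ¬P0 = contradiction P0 ¬P0
least P? (suc n) Pn | no ¬P0 =
  let (m , Pm , min) = least (P? ∘ suc) n Pn in
  suc m , Pm , λ { zero P0 → contradiction P0 ¬P0 ; (suc r) Pr → s≤s (min r Pr) }

-- Without function extensionality, only predicates invariant under a given
-- relation (pointwise equality, for functions) can be searched exhaustively.
Searchable : (X : Set) → (X → X → Set) → (X → Set) → Set₁
Searchable X _≈_ D = (P : X → Set) → (∀ {x y} → x ≈ y → P x → P y) → (∀ x → Dec (P x)) →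
  Dec (∃[ x ] (D x × P x))

-- Searches for a head that admits a suitable tail. Splitting `f` into head and tail and
-- reassembling it gives back only a pointwise equal function, so each stage of the recursion passes
-- through `resp`.
search-Π : ∀ n {X : Fin n → Set} {_≈_ : ∀ {i} → X i → X i → Set} {D : ∀ {i} → X i → Set} →
  (∀ {i} (x : X i) → x ≈ x) → (∀ i → Searchable (X i) _≈_ D) →
  Searchable (∀ i → X i) (λ f g → ∀ i → f i ≈ g i) (λ f → ∀ i → D (f i))
search-Π zero {X} ≈-refl search P resp P? = map′
  (λ p → none , (λ ()) , p) (λ { (f , _ , p) → resp {f} {none} (λ ()) p }) (P? none)
  where
  none : ∀ i → X i
  none ()
search-Π (suc n) {X} {_≈_} {D} ≈-refl search P resp P? = map′
  (λ { (x , Dx , f , Df , p) → ∀-cons x f , ∀-cons Dx Df , p })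
  (λ { (f , Df , p) → f zero , Df zero , f ∘ suc , Df ∘ suc ,
       resp (∀-cons {P = λ i → f i ≈ ∀-cons {P = X} (f zero) (f ∘ suc) i} (≈-refl _) (λ i → ≈-refl _)) p })
  (search zero (λ x → ∃[ f ] ((∀ i → D (f i)) × P (∀-cons x f)))
    (λ {x} {y} x≈y → λ { (f , Df , p) → f , Df ,
       resp (∀-cons {P = λ i → ∀-cons {P = X} x f i ≈ ∀-cons {P = X} y f i} x≈y (λ i → ≈-refl _)) p })
    (λ x → search-Π n ≈-refl (search ∘ suc) (λ f → P (∀-cons x f))
       (λ {f} {g} f≈g → resp (∀-cons {P = λ i → ∀-cons {P = X} x f i ≈ ∀-cons {P = X} x g i} (≈-refl _) f≈g))
       (λ f → P? (∀-cons x f))))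

Unbounded : {X : Set} → X → Set
Unbounded _ = ⊤

module LinearAlgebra (𝔽 : FiniteField) where
  open LinAlg 𝔽

  𝔽-ring : CommutativeRing 0ℓ 0ℓ
  𝔽-ring = record { isCommutativeRing = isCommutativeRing }

  open CommutativeRing 𝔽-ring public
    using ( +-assoc; +-comm; +-identityˡ; +-identityʳ; -‿inverseˡ; -‿inverseʳ
          ; *-assoc; *-comm; *-identityˡ; *-identityʳ; distribˡ; distribʳ; zeroˡ; zeroʳ
          ; ring; semiring )
  open import Algebra.Properties.Ring ring public using (-‿distribˡ-*; -‿distribʳ-*)
  open import Algebra.Properties.Semiring.Sum semiring
    using (sum; sum-remove; ∑-distrib-+; ∑-comm; *-distribˡ-sum; *-distribʳ-sum)

  open ≡-Reasoning

  -- Finite sums over the field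

  sumF-cong : ∀ {n} {f g : Fin n → Carrier} → f ≗ g → sumF n f ≡ sumF n g
  sumF-cong {zero}  f≗g = refl
  sumF-cong {suc n} f≗g = cong₂ _+_ (f≗g zero) (sumF-cong (f≗g ∘ suc))

  sumF-zero : ∀ n {f : Fin n → Carrier} → f ≗ 0v → sumF n f ≡ 0#
  sumF-zero zero    f≗0 = refl
  sumF-zero (suc n) f≗0 = trans (cong₂ _+_ (f≗0 zero) (sumF-zero n (f≗0 ∘ suc))) (+-identityˡ 0#)

  sumF≡sum : ∀ {n} (f : Fin n → Carrier) → sumF n f ≡ sum f
  sumF≡sum {zero}  f = refl
  sumF≡sum {suc n} f = cong (f zero +_) (sumF≡sum (f ∘ suc))

  sumF-+ : ∀ n (f g : Fin n → Carrier) → sumF n (λ t → f t + g t) ≡ sumF n f + sumF n g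
  sumF-+ n f g = begin
    sumF n (λ t → f t + g t)  ≡⟨ sumF≡sum {n} _ ⟩
    sum (λ t → f t + g t)     ≡⟨ ∑-distrib-+ f g ⟩
    sum f + sum g             ≡⟨ cong₂ _+_ (sumF≡sum f) (sumF≡sum g) ⟨
    sumF n f + sumF n g       ∎

  *-sumF : ∀ n x (f : Fin n → Carrier) → x * sumF n f ≡ sumF n (λ t → x * f t)
  *-sumF n x f = trans (cong (x *_) (sumF≡sum f)) (trans (*-distribˡ-sum x f) (sym (sumF≡sum {n} _)))

  sumF-* : ∀ n (f : Fin n → Carrier) x → sumF n f * x ≡ sumF n (λ t → f t * x)
  sumF-* n f x = trans (cong (_* x) (sumF≡sum f)) (trans (*-distribʳ-sum x f) (sym (sumF≡sum {n} _)))

  sumF-comm : ∀ m n (f : Fin m → Fin n → Carrier) →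
    sumF m (λ i → sumF n (f i)) ≡ sumF n (λ j → sumF m (λ i → f i j))
  sumF-comm m n f = begin
    sumF m (λ i → sumF n (f i))          ≡⟨ sumF-cong (λ i → sumF≡sum (f i)) ⟩
    sumF m (λ i → sum (f i))             ≡⟨ sumF≡sum {m} _ ⟩
    sum (λ i → sum (f i))                ≡⟨ ∑-comm f ⟩
    sum (λ j → sum (λ i → f i j))        ≡⟨ sumF≡sum {n} _ ⟨
    sumF n (λ j → sum (λ i → f i j))     ≡⟨ sumF-cong (λ j → sumF≡sum (λ i → f i j)) ⟨
    sumF n (λ j → sumF m (λ i → f i j))  ∎

  sumF-remove : ∀ {n} p (f : Fin (suc n) → Carrier) → sumF (suc n) f ≡ f p + sumF n (f ∘ punchIn p)
  sumF-remove p f = trans (sumF≡sum f) (trans (sum-remove {i = p} f) (cong (f p +_) (sym (sumF≡sum (f ∘ punchIn p)))))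

  -- Associativity a(Bc) = (aB)c of row vector, matrix and column vector. Nested linear
  -- combinations, the adjunction and the coordinate expansions below are all instances.
  sumF-comm-* : ∀ {m n} (a : Fin m → Carrier) (b : Fin m → Fin n → Carrier) (c : Fin n → Carrier) →
    sumF m (λ i → a i * sumF n (λ j → b i j * c j)) ≡ sumF n (λ j → sumF m (λ i → a i * b i j) * c j)
  sumF-comm-* {m} {n} a b c = begin
    sumF m (λ i → a i * sumF n (λ j → b i j * c j))
      ≡⟨ sumF-cong (λ i → trans (*-sumF n (a i) _) (sumF-cong (λ j → sym (*-assoc (a i) (b i j) (c j))))) ⟩
    sumF m (λ i → sumF n (λ j → a i * b i j * c j))
      ≡⟨ sumF-comm m n _ ⟩
    sumF n (λ j → sumF m (λ i → a i * b i j * c j))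
      ≡⟨ sumF-cong (λ j → sumF-* m (λ i → a i * b i j) (c j)) ⟨
    sumF n (λ j → sumF m (λ i → a i * b i j) * c j) ∎

  sumF-closed : ∀ {K} → IsSubfield K → ∀ {n} {f : Fin n → Carrier} → (∀ t → K (f t)) → K (sumF n f)
  sumF-closed sub {zero}  f∈K = IsSubfield.0∈ sub
  sumF-closed sub {suc n} f∈K = IsSubfield.+∈ sub (f∈K zero) (sumF-closed sub (f∈K ∘ suc))

  δ : ∀ {n} → Fin n → Fin n → Carrier
  δ zero    zero    = 1#
  δ zero    (suc j) = 0#
  δ (suc i) zero    = 0#
  δ (suc i) (suc j) = δ i j

  sumF-δˡ : ∀ {n} p (f : Fin n → Carrier) → sumF n (λ t → δ p t * f t) ≡ f p
  sumF-δˡ {suc n} zero f = trans (cong₂ _+_ (*-identityˡ _) (sumF-zero n (λ t → zeroˡ _))) (+-identityʳ _)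
  sumF-δˡ (suc p) f = trans (cong₂ _+_ (zeroˡ _) (sumF-δˡ p (f ∘ suc))) (+-identityˡ _)

  sumF-δʳ : ∀ {n} p (f : Fin n → Carrier) → sumF n (λ t → f t * δ t p) ≡ f p
  sumF-δʳ {suc n} zero f = trans (cong₂ _+_ (*-identityʳ _) (sumF-zero n (λ t → zeroʳ _))) (+-identityʳ _)
  sumF-δʳ (suc p) f = trans (cong₂ _+_ (zeroʳ _) (sumF-δʳ p (f ∘ suc))) (+-identityˡ _)

  x≡0⇒x+y≡y : ∀ {x} y → x ≡ 0# → x + y ≡ y
  x≡0⇒x+y≡y y refl = +-identityˡ y

  x*0+y≡y : ∀ x y → x * 0# + y ≡ y
  x*0+y≡y x y = x≡0⇒x+y≡y y (zeroʳ x)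

  x*1+0≡x : ∀ x {y} → y ≡ 0# → x * 1# + y ≡ x
  x*1+0≡x x refl = trans (+-identityʳ _) (*-identityʳ x)

  x+[y-x]≡y : ∀ x y → x + (y + - x) ≡ y
  x+[y-x]≡y x y = begin
    x + (y + - x)  ≡⟨ cong (x +_) (+-comm y (- x)) ⟩
    x + (- x + y)  ≡⟨ +-assoc x (- x) y ⟨
    (x + - x) + y  ≡⟨ cong (_+ y) (-‿inverseʳ x) ⟩
    0# + y         ≡⟨ +-identityˡ y ⟩
    y              ∎

  x+y≡0⇒x≡-y : ∀ {x y} → x + y ≡ 0# → x ≡ - y
  x+y≡0⇒x≡-y {x} {y} x+y≡0 = begin
    x              ≡⟨ x+[y-x]≡y y x ⟨
    y + (x + - y)  ≡⟨ +-assoc y x (- y) ⟨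
    (y + x) + - y  ≡⟨ cong (_+ - y) (trans (+-comm y x) x+y≡0) ⟩
    0# + - y       ≡⟨ +-identityˡ (- y) ⟩
    - y            ∎

  -- Spans

  module _ {I : Set} where

    lincomb-assoc : ∀ {d e} (c : Fin d → Carrier) (m : Fin d → Fin e → Carrier) (v : Fin e → I → Carrier) →
      lincomb d c (λ t → lincomb e (m t) v) ≗ lincomb e (lincomb d c m) v
    lincomb-assoc c m v ι = sumF-comm-* c m (λ s → v s ι)

    lincomb-cong : ∀ {d} (c : Fin d → Carrier) {v w : Fin d → I → Carrier} →
      (∀ t → v t ≗ w t) → lincomb d c v ≗ lincomb d c w
    lincomb-cong c v≗w ι = sumF-cong (λ t → cong (c t *_) (v≗w t ι))

    Span : ∀ {d} → (Fin d → I → Carrier) → (I → Carrier) → Set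
    Span = InSpan AllF

    span-resp : ∀ {d} {v : Fin d → I → Carrier} {x y} → x ≗ y → Span v x → Span v y
    span-resp x≗y (c , _ , eq) = c , _ , λ ι → trans (sym (x≗y ι)) (eq ι)

    span-generator : ∀ {d} (v : Fin d → I → Carrier) t → Span v (v t)
    span-generator v t = δ t , _ , λ ι → sym (sumF-δˡ t (λ s → v s ι))

    span-trans : ∀ {d e} {v : Fin d → I → Carrier} {w : Fin e → I → Carrier} {x} →
      (∀ t → Span w (v t)) → Span v x → Span w x
    span-trans {w = w} v⊆w (c , _ , eq) = _ , _ , λ ι →
      trans (eq ι) (trans (lincomb-cong c (λ t → proj₂ (proj₂ (v⊆w t))) ι)
                          (lincomb-assoc c (λ t → proj₁ (v⊆w t)) w ι))

    span-combine : ∀ {d} {v : Fin d → I → Carrier} {x y} a b →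
      Span v x → Span v y → Span v (λ ι → a * x ι + b * y ι)
    span-combine {x = x} {y} a b x∈ y∈ = span-trans {d = 2} {v = x ∷ y ∷ λ ()}
      (λ { zero → x∈ ; (suc zero) → y∈ })
      ((a ∷ b ∷ λ ()) , _ , λ ι → cong (a * x ι +_) (sym (+-identityʳ _)))

  -- Independence and the exchange inequality

  1-dependent : ∀ {e} (u : Fin (suc e) → Fin 0 → Carrier) → ¬ Independent AllF u
  1-dependent u ind = 0≢1 (sym (ind (λ _ → 1#) _ (λ ()) zero))

  -- Induction on the coordinates. If the first one vanishes on every vector, it is discarded.
  -- Otherwise a pivot vector clears it from the others, which costs one vector and one coordinate.
  independent⇒≤ : ∀ d {e} (u : Fin e → Fin d → Carrier) → Independent AllF u → e ≤ d
  independent⇒≤ zero    {zero}  u ind = z≤n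
  independent⇒≤ zero    {suc e} u ind = contradiction ind (1-dependent u)
  independent⇒≤ (suc d) {zero}  u ind = z≤n
  independent⇒≤ (suc d) {suc e} u ind with any? (λ t → ¬? (u t zero ≟ 0#))
  ... | no ¬pivot = ℕ.m≤n⇒m≤1+n (independent⇒≤ d (tail ∘ u) λ c _ eq → ind c _
          λ { zero → sumF-zero (suc e) (λ t → trans (cong (c t *_) (col0 t)) (zeroʳ _)) ; (suc j) → eq j })
    where
    col0 : ∀ t → u t zero ≡ 0#
    col0 t = decidable-stable (_ ≟ _) (λ ≢0 → ¬pivot (t , ≢0))
  ... | yes (p , up≢0) = s≤s (independent⇒≤ d (λ t → tail (u′ t)) ind′)
    where
    q = proj₁ (inverse _ up≢0)
    f : Fin e → Carrier
    f t = - (u (punchIn p t) zero * q)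
    u′ : Fin e → Fin (suc d) → Carrier
    u′ t j = u (punchIn p t) j + f t * u p j
    u′-head : ∀ t → u′ t zero ≡ 0#
    u′-head t = begin
      x + - (x * q) * y    ≡⟨ cong (x +_) (sym (-‿distribˡ-* (x * q) y)) ⟩
      x + - (x * q * y)    ≡⟨ cong (λ z → x + - z) (trans (*-assoc x q y)
                                (trans (cong (x *_) (trans (*-comm q y) (proj₂ (inverse _ up≢0)))) (*-identityʳ x))) ⟩
      x + - x              ≡⟨ -‿inverseʳ x ⟩
      0#                   ∎
      where x = u (punchIn p t) zero
            y = u p zero
    ind′ : Independent AllF (λ t → tail (u′ t))
    ind′ c _ eq t = trans (sym (insertAt-punchIn c p c₀ t)) (ind c̃ _ total (punchIn p t))
      where
      -- A relation `c` among the cleared vectors is a relation among the original ones once the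
      -- pivot receives the total of the multiples of it that were added.
      c₀ = sumF e (λ s → c s * f s)
      c̃ = insertAt c p c₀
      expand : lincomb (suc e) c̃ u ≗ lincomb e c u′
      expand j = begin
        lincomb (suc e) c̃ u j
          ≡⟨ sumF-remove p (λ s → c̃ s * u s j) ⟩
        c̃ p * u p j + sumF e (λ s → c̃ (punchIn p s) * u (punchIn p s) j)
          ≡⟨ cong₂ _+_ (cong (_* u p j) (insertAt-lookup c p c₀))
               (sumF-cong (λ s → cong (_* u (punchIn p s) j) (insertAt-punchIn c p c₀ s))) ⟩
        c₀ * u p j + sumF e (λ s → c s * u (punchIn p s) j)
          ≡⟨ +-comm _ _ ⟩
        sumF e (λ s → c s * u (punchIn p s) j) + c₀ * u p j
          ≡⟨ cong (_ +_) (trans (sumF-* e _ (u p j)) (sumF-cong (λ s → *-assoc (c s) (f s) (u p j)))) ⟩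
        sumF e (λ s → c s * u (punchIn p s) j) + sumF e (λ s → c s * (f s * u p j))
          ≡⟨ sumF-+ e _ _ ⟨
        sumF e (λ s → c s * u (punchIn p s) j + c s * (f s * u p j))
          ≡⟨ sumF-cong (λ s → distribˡ (c s) _ _) ⟨
        lincomb e c u′ j ∎
      total : lincomb (suc e) c̃ u ≗ 0v
      total zero    = trans (expand zero) (sumF-zero e (λ s → trans (cong (c s *_) (u′-head s)) (zeroʳ _)))
      total (suc j) = trans (expand (suc j)) (eq j)

  -- The coefficient vectors of the `u t` with respect to `v` are independent in 𝔽^d, because a
  -- relation among them is also a relation among the `u t`.
  steinitz : ∀ {I : Set} {d e} {u : Fin e → I → Carrier} {v : Fin d → I → Carrier} →
    Independent AllF u → (∀ t → Span v (u t)) → e ≤ d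
  steinitz {d = d} {e} {u} {v} ind u⊆v = independent⇒≤ d m λ c _ eq → ind c _ λ ι → begin
    lincomb e c u ι                          ≡⟨ lincomb-cong c (λ t → proj₂ (proj₂ (u⊆v t))) ι ⟩
    lincomb e c (λ t → lincomb d (m t) v) ι  ≡⟨ lincomb-assoc c m v ι ⟩
    lincomb d (lincomb e c m) v ι            ≡⟨ sumF-zero d (λ s → trans (cong (_* v s ι) (eq s)) (zeroˡ _)) ⟩
    0#                                       ∎
    where
    m : Fin e → Fin d → Carrier
    m t = proj₁ (u⊆v t)

  basis-size≤ : ∀ {I : Set} {d e} {W : (I → Carrier) → Set} → HasDim AllF W d → HasDim AllF W e → d ≤ e
  basis-size≤ (v , v∈ , v-indep , _) (w , _ , _ , spans) = steinitz v-indep (λ t → spans (v t) (v∈ t))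

  -- Gaussian elimination

  -- R is a basis of the row space of M and K one of its kernel; ⊥K⇒∈R is the double-annihilator property.
  record Annihilators {I : Set} (_·_ : (I → Carrier) → (I → Carrier) → Carrier)
                      {a} (M : Fin a → I → Carrier) (b : ℕ) : Set where
    field
      rank null : ℕ
      rank+null : rank ℕ.+ null ≡ b
      R : Fin rank → I → Carrier
      K : Fin null → I → Carrier
      R-independent : Independent AllF R
      K-independent : Independent AllF K
      R⊆M : ∀ t → Span M (R t)
      M⊥K : ∀ i t → M i · K t ≡ 0#
      ⊥K⇒∈R : ∀ x → (∀ t → x · K t ≡ 0#) → Span R x
      ⊥R⇒∈K : ∀ x → (∀ t → R t · x ≡ 0#) → Span K x

  dotF : ∀ {b} → (Fin b → Carrier) → (Fin b → Carrier) → Carrier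
  dotF {b} x y = sumF b (λ j → x j * y j)

  dotF-comm : ∀ {b} (x y : Fin b → Carrier) → dotF x y ≡ dotF y x
  dotF-comm x y = sumF-cong (λ j → *-comm (x j) (y j))

  dotF-lincombˡ : ∀ {b d} (c : Fin d → Carrier) (v : Fin d → Fin b → Carrier) y →
    dotF (lincomb d c v) y ≡ sumF d (λ t → c t * dotF (v t) y)
  dotF-lincombˡ c v y = sym (sumF-comm-* c v y)

  dotF-lincombʳ : ∀ {b d} x (c : Fin d → Carrier) (v : Fin d → Fin b → Carrier) →
    dotF x (lincomb d c v) ≡ sumF d (λ t → c t * dotF x (v t))
  dotF-lincombʳ x c v = trans (dotF-comm x _) (trans (dotF-lincombˡ c v x)
    (sumF-cong (λ t → cong (c t *_) (dotF-comm (v t) x))))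

  -- The right-hand side is the dot product of `m ∷ x` with `(- dotF w y) ∷ y`. Reducing a row by
  -- the pivot row thus amounts to giving the kernel vector a suitable head, and orthogonality
  -- passes both ways between the reduced and the full matrix.
  dotF-subˡ : ∀ {b} (x : Fin b → Carrier) m w y →
    dotF (λ j → x j + - (m * w j)) y ≡ m * - dotF w y + dotF x y
  dotF-subˡ {b} x m w y = begin
    sumF b (λ j → (x j + - (m * w j)) * y j)
      ≡⟨ sumF-cong (λ j → trans (distribʳ (y j) _ _) (trans (+-comm _ _) (cong (_+ x j * y j) (lemma (w j) (y j))))) ⟩
    sumF b (λ j → - m * (w j * y j) + x j * y j)
      ≡⟨ sumF-+ b _ _ ⟩
    sumF b (λ j → - m * (w j * y j)) + dotF x y
      ≡⟨ cong (_+ dotF x y) (trans (sym (*-sumF b (- m) _)) (trans (sym (-‿distribˡ-* m _)) (-‿distribʳ-* m _))) ⟩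
    m * - dotF w y + dotF x y ∎
    where
    lemma : ∀ w y → - (m * w) * y ≡ - m * (w * y)
    lemma w y = trans (cong (_* y) (-‿distribˡ-* m w)) (*-assoc (- m) w y)

  sumF-*0 : ∀ {n} (c : Fin n → Carrier) → sumF n (λ t → c t * 0#) ≡ 0#
  sumF-*0 {n} c = sumF-zero n (λ t → zeroʳ (c t))

  -- Recursion on the columns. A zero column adds the first unit vector to `K` and pads everything
  -- else with 0. A pivot column adds the normalised pivot row `w` to `R`, and every kernel vector
  -- of the reduced matrix is extended by the one head that makes it orthogonal to `w`.
  annihilators : ∀ {a} b (M : Fin a → Fin b → Carrier) → Annihilators dotF M b
  annihilators zero M = record
    { rank = 0 ; null = 0 ; rank+null = refl
    ; R = λ () ; K = λ ()
    ; R-independent = λ _ _ _ () ; K-independent = λ _ _ _ ()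
    ; R⊆M = λ () ; M⊥K = λ _ ()
    ; ⊥K⇒∈R = λ _ _ → (λ ()) , _ , λ ()
    ; ⊥R⇒∈K = λ _ _ → (λ ()) , _ , λ () }
  annihilators {a} (suc b) M with any? (λ i → ¬? (M i zero ≟ 0#))
  ... | no ¬pivot = record
    { rank = S.rank ; null = suc S.null
    ; rank+null = trans (ℕ.+-suc S.rank S.null) (cong suc S.rank+null)
    ; R = R ; K = K
    ; R-independent = λ c _ eq → S.R-independent c _ (eq ∘ suc)
    ; K-independent = K-independent
    ; R⊆M = λ t → let (c , _ , eq) = S.R⊆M t in c , _ ,
        λ { zero → sym (sumF-zero a (λ i → trans (cong (c i *_) (col0 i)) (zeroʳ _))) ; (suc j) → eq j }
    ; M⊥K = λ { i zero → trans (x*1+0≡x _ (sumF-*0 (tail (M i)))) (col0 i)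
              ; i (suc t) → trans (x*0+y≡y _ _) (S.M⊥K i t) }
    ; ⊥K⇒∈R = ⊥K⇒∈R
    ; ⊥R⇒∈K = ⊥R⇒∈K }
    where
    col0 : ∀ i → M i zero ≡ 0#
    col0 i = decidable-stable (_ ≟ _) (λ ≢0 → ¬pivot (i , ≢0))
    module S = Annihilators (annihilators b (λ i → tail (M i)))
    R : Fin S.rank → Fin (suc b) → Carrier
    R t = 0# ∷ S.R t
    K : Fin (suc S.null) → Fin (suc b) → Carrier
    K = (1# ∷ 0v) ∷ (λ t → 0# ∷ S.K t)
    K-independent : Independent AllF K
    K-independent c _ eq zero = trans (sym (x*1+0≡x _ (sumF-*0 (tail c)))) (eq zero)
    K-independent c _ eq (suc t) =
      S.K-independent (tail c) _ (λ j → trans (sym (x*0+y≡y _ _)) (eq (suc j))) t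
    ⊥K⇒∈R : ∀ x → (∀ t → dotF x (K t) ≡ 0#) → Span R x
    ⊥K⇒∈R x x⊥K =
      let (c , _ , eq) = S.⊥K⇒∈R (tail x) (λ t → trans (sym (x*0+y≡y _ _)) (x⊥K (suc t)))
      in c , _ , λ { zero → trans (trans (sym (x*1+0≡x _ (sumF-*0 (tail x)))) (x⊥K zero)) (sym (sumF-*0 c))
                   ; (suc j) → eq j }
    ⊥R⇒∈K : ∀ x → (∀ t → dotF (R t) x ≡ 0#) → Span K x
    ⊥R⇒∈K x R⊥x =
      let (c , _ , eq) = S.⊥R⇒∈K (tail x)
            (λ t → trans (sym (x≡0⇒x+y≡y _ (zeroˡ (x zero)))) (R⊥x t))
      in (x zero ∷ c) , _ , λ { zero → sym (x*1+0≡x _ (sumF-*0 c))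
                              ; (suc j) → trans (eq j) (sym (x*0+y≡y _ _)) }
  ... | yes (p , Mp≢0) = record
    { rank = suc S.rank ; null = S.null ; rank+null = cong suc S.rank+null
    ; R = R ; K = K
    ; R-independent = R-independent
    ; K-independent = λ c _ eq → S.K-independent c _ (eq ∘ suc)
    ; R⊆M = R⊆M
    ; M⊥K = λ i t → trans (sym (dotF-subˡ (tail (M i)) (M i zero) (tail w) (S.K t))) (S.M⊥K i t)
    ; ⊥K⇒∈R = ⊥K⇒∈R
    ; ⊥R⇒∈K = ⊥R⇒∈K }
    where
    q = proj₁ (inverse _ Mp≢0)
    w : Fin (suc b) → Carrier
    w j = q * M p j
    w₀≡1 : w zero ≡ 1#
    w₀≡1 = trans (*-comm q _) (proj₂ (inverse _ Mp≢0))
    -- All `a` rows are kept: the pivot row itself reduces to zero, so no reindexing occurs.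
    module S = Annihilators (annihilators b (λ i j → M i (suc j) + - (M i zero * w (suc j))))
    R : Fin (suc S.rank) → Fin (suc b) → Carrier
    R = w ∷ (λ t → 0# ∷ S.R t)
    K : Fin S.null → Fin (suc b) → Carrier
    K t = (- dotF (tail w) (S.K t)) ∷ S.K t
    head-lincomb-R : ∀ c → lincomb _ c R zero ≡ c zero
    head-lincomb-R c = trans (cong (λ z → c zero * z + sumF S.rank (λ t → tail c t * 0#)) w₀≡1) (x*1+0≡x _ (sumF-*0 (tail c)))
    R-independent : Independent AllF R
    R-independent c _ eq = λ { zero → c₀≡0 ; (suc t) → S.R-independent (tail c) _ tail≗0 t }
      where
      c₀≡0 = trans (sym (head-lincomb-R c)) (eq zero)
      tail≗0 : lincomb S.rank (tail c) S.R ≗ 0v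
      tail≗0 j = trans (sym (x≡0⇒x+y≡y _ (trans (cong (_* w (suc j)) c₀≡0) (zeroˡ _))))
                       (eq (suc j))
    reduced : Fin a → Fin (suc b) → Carrier
    reduced i j = M i j + - (M i zero * w j)
    reduced₀≡0 : ∀ i → reduced i zero ≡ 0#
    reduced₀≡0 i = trans (cong (λ z → M i zero + - z) (trans (cong (M i zero *_) w₀≡1) (*-identityʳ _))) (-‿inverseʳ _)
    w∈M : Span M w
    w∈M = span-resp (λ j → trans (+-comm _ _) (x≡0⇒x+y≡y _ (zeroˡ _)))
            (span-combine q 0# (span-generator M p) (span-generator M p))
    reduced∈M : ∀ i → Span M (reduced i)
    reduced∈M i = span-resp (λ j → cong₂ _+_ (*-identityˡ _) (sym (-‿distribˡ-* (M i zero) (w j))))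
                    (span-combine 1# (- M i zero) (span-generator M i) w∈M)
    R⊆M : ∀ t → Span M (R t)
    R⊆M zero = w∈M
    R⊆M (suc t) = let (c , _ , eq) = S.R⊆M t in span-trans {v = reduced} reduced∈M (c , _ ,
      λ { zero → sym (sumF-zero a (λ i → trans (cong (c i *_) (reduced₀≡0 i)) (zeroʳ _))) ; (suc j) → eq j })
    ⊥K⇒∈R : ∀ x → (∀ t → dotF x (K t) ≡ 0#) → Span R x
    ⊥K⇒∈R x x⊥K =
      let (c , _ , eq) = S.⊥K⇒∈R (λ j → x (suc j) + - (x zero * w (suc j)))
                           (λ t → trans (dotF-subˡ (tail x) (x zero) (tail w) (S.K t)) (x⊥K t))
      in (x zero ∷ c) , _ , λ { zero → sym (head-lincomb-R (x zero ∷ c))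
                              ; (suc j) → trans (sym (x+[y-x]≡y _ _)) (cong (x zero * w (suc j) +_) (eq j)) }
    ⊥R⇒∈K : ∀ x → (∀ t → dotF (R t) x ≡ 0#) → Span K x
    ⊥R⇒∈K x R⊥x =
      let (c , _ , eq) = S.⊥R⇒∈K (tail x)
            (λ t → trans (sym (x≡0⇒x+y≡y _ (zeroˡ (x zero)))) (R⊥x (suc t)))
      -- Since `w` has head 1, orthogonality to `w` makes the head of `x` minus the product of the
      -- tails, which is linear in the tail and agrees with the heads chosen in `K`.
      in c , _ , λ { (suc j) → eq j ; zero → begin
        x zero
          ≡⟨ x+y≡0⇒x≡-y (trans (cong (_+ dotF (tail w) (tail x)) (trans (sym (*-identityˡ _)) (cong (_* x zero) (sym w₀≡1)))) (R⊥x zero)) ⟩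
        - dotF (tail w) (tail x)
          ≡⟨ cong -_ (sumF-cong (λ j → cong (w (suc j) *_) (eq j))) ⟩
        - dotF (tail w) (lincomb S.null c S.K)
          ≡⟨ cong -_ (dotF-lincombʳ (tail w) c S.K) ⟩
        - sumF S.null (λ t → c t * dotF (tail w) (S.K t))
          ≡⟨ trans (cong -_ (sym (*-identityˡ _))) (trans (-‿distribˡ-* 1# _) (*-sumF S.null (- 1#) _)) ⟩
        sumF S.null (λ t → - 1# * (c t * dotF (tail w) (S.K t)))
          ≡⟨ sumF-cong (λ t → trans (sym (-‿distribˡ-* 1# _)) (trans (cong -_ (*-identityˡ _)) (-‿distribʳ-* (c t) _))) ⟩
        sumF S.null (λ t → c t * - dotF (tail w) (S.K t)) ∎ }

  -- Vectors indexed by blocks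

  sumF-↑ : ∀ m n (f : Fin (m ℕ.+ n) → Carrier) →
    sumF (m ℕ.+ n) f ≡ sumF m (λ j → f (j ↑ˡ n)) + sumF n (λ j → f (m ↑ʳ j))
  sumF-↑ zero    n f = sym (+-identityˡ _)
  sumF-↑ (suc m) n f = trans (cong (f zero +_) (sumF-↑ m n (f ∘ suc))) (sym (+-assoc _ _ _))

  sumF-unflatten : ∀ ℓ (N : Fin ℓ → ℕ) (g : Blocks ℓ N → Carrier) →
    sumF ℓ (λ i → sumF (N i) (λ j → g (i , j))) ≡ sumF (Σℕ ℓ N) (g ∘ unflatten ℓ N)
  sumF-unflatten zero    N g = refl
  sumF-unflatten (suc ℓ) N g = sym (trans (sumF-↑ (N zero) (Σℕ ℓ (N ∘ suc)) _) (cong₂ _+_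
    (sumF-cong (λ j → cong (g ∘ [ zero ,_ , shift ∘ unflatten ℓ (N ∘ suc) ]′) (splitAt-↑ˡ (N zero) j _)))
    (trans (sumF-cong (λ y → cong (g ∘ [ zero ,_ , shift ∘ unflatten ℓ (N ∘ suc) ]′) (splitAt-↑ʳ (N zero) _ y)))
           (sym (sumF-unflatten ℓ (N ∘ suc) (g ∘ shift))))))

  dotB : ∀ {ℓ} (N : Fin ℓ → ℕ) (x y : Blocks ℓ N → Carrier) → Carrier
  dotB {ℓ} N x y = sumF ℓ (λ i → sumF (N i) (λ j → x (i , j) * y (i , j)))

  module _ {ℓ} (N : Fin ℓ → ℕ) where

    dotB≡dotF : ∀ x y → dotB N x y ≡ dotF (x ∘ unflatten ℓ N) (y ∘ unflatten ℓ N)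
    dotB≡dotF x y = sumF-unflatten ℓ N (λ ι → x ι * y ι)

    dotB-comm : ∀ x y → dotB N x y ≡ dotB N y x
    dotB-comm x y = sumF-cong (λ i → dotF-comm (λ j → x (i , j)) (λ j → y (i , j)))

    dotB-congʳ : ∀ x {y z} → y ≗ z → dotB N x y ≡ dotB N x z
    dotB-congʳ x y≗z = sumF-cong (λ i → sumF-cong (λ j → cong (x (i , j) *_) (y≗z (i , j))))

    dotB-span-zero : ∀ {d} {v : Fin d → Blocks ℓ N → Carrier} {x y} →
      (∀ t → dotB N x (v t) ≡ 0#) → Span v y → dotB N x y ≡ 0#
    dotB-span-zero {d} {v} {x} {y} x⊥v (c , _ , eq) = begin
      dotB N x y                                  ≡⟨ dotB-congʳ x eq ⟩
      dotB N x (lincomb d c v)                    ≡⟨ dotB≡dotF x (lincomb d c v) ⟩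
      dotF (x ∘ unflatten ℓ N) (lincomb d c (λ t → v t ∘ unflatten ℓ N))
        ≡⟨ dotF-lincombʳ (x ∘ unflatten ℓ N) c (λ t → v t ∘ unflatten ℓ N) ⟩
      sumF d (λ t → c t * dotF (x ∘ unflatten ℓ N) (v t ∘ unflatten ℓ N))
        ≡⟨ sumF-zero d (λ t → trans (cong (c t *_) (trans (sym (dotB≡dotF x (v t))) (x⊥v t))) (zeroʳ _)) ⟩
      0# ∎

    annihilatorsB : ∀ {a} (M : Fin a → Blocks ℓ N → Carrier) → Annihilators (dotB N) M (Σℕ ℓ N)
    annihilatorsB M = record
      { rank+null = S.rank+null
      ; R = λ t → S.R t ∘ enc ; K = λ t → S.K t ∘ enc
      ; R-independent = λ c _ eq → S.R-independent c _ (surjective eq)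
      ; K-independent = λ c _ eq → S.K-independent c _ (surjective eq)
      ; R⊆M = λ t → back (S.R⊆M t)
      ; M⊥K = λ i t → trans (dotB≡dotF _ _) (trans (sumF-cong (λ x → cong (λ y → M i (dec x) * S.K t y) (enc-dec x))) (S.M⊥K i t))
      ; ⊥K⇒∈R = λ x x⊥K → span-resp (λ ι → cong x (dec-enc ι)) (restrict (S.⊥K⇒∈R (x ∘ dec) λ t →
          trans (sym (trans (dotB≡dotF _ _) (sumF-cong (λ j → cong (λ y → x (dec j) * S.K t y) (enc-dec j))))) (x⊥K t)))
      ; ⊥R⇒∈K = λ x R⊥x → span-resp (λ ι → cong x (dec-enc ι)) (restrict (S.⊥R⇒∈K (x ∘ dec) λ t →
          trans (sym (trans (dotB≡dotF _ _) (sumF-cong (λ j → cong (λ y → S.R t y * x (dec j)) (enc-dec j))))) (R⊥x t)))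
      }
      where
      dec = unflatten ℓ N
      enc = flatten ℓ N
      dec-enc = unflatten-flatten ℓ N
      enc-dec = flatten-unflatten ℓ N
      module S = Annihilators (annihilators (Σℕ ℓ N) (λ i → M i ∘ dec))
      surjective : ∀ {x : Fin (Σℕ ℓ N) → Carrier} → x ∘ enc ≗ 0v → x ≗ 0v
      surjective {x} eq j = trans (cong x (sym (enc-dec j))) (eq (dec j))
      restrict : ∀ {d} {v : Fin d → Fin (Σℕ ℓ N) → Carrier} {x} → Span v x → Span (λ t → v t ∘ enc) (x ∘ enc)
      restrict (c , _ , eq) = c , _ , eq ∘ enc
      back : ∀ {x} → Span (λ i → M i ∘ dec) x → Span M (x ∘ enc)
      back (c , _ , eq) = c , _ , λ ι → trans (eq (enc ι)) (sumF-cong (λ t → cong (λ y → c t * M t y) (dec-enc ι)))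

module SumRankCode
  (𝔽 : FiniteField) (ℓ : ℕ) (ns : Fin ℓ → ℕ)
  (Ks : Fin ℓ → FiniteField.Carrier 𝔽 → Set) (ms : Fin ℓ → ℕ)
  (γ : (i : Fin ℓ) → Fin (ms i) → FiniteField.Carrier 𝔽)
  (subfield : ∀ i → LinAlg.IsSubfield 𝔽 (Ks i))
  (γ-basis : ∀ i → LinAlg.IsBasis 𝔽 {I = ⊤} (Ks i) (λ _ → ⊤) (λ r _ → γ i r))
  (k : ℕ) (G : Fin k → Blocks ℓ ns → FiniteField.Carrier 𝔽)
  where

  open SumRank 𝔽 ℓ ns Ks ms γ
  open LinearAlgebra 𝔽

  -- The projection x ↦ xAᵀ and its transpose u ↦ uA

  -- Bare rows, with neither membership in `Ks` nor independence required: the search evaluates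
  -- ranks and nullities on arbitrary candidates, valid or not.
  Matrices : (Fin ℓ → ℕ) → Set
  Matrices N = (i : Fin ℓ) → Fin (N i) → Fin (ns i) → Carrier

  module _ {N : Fin ℓ → ℕ} (A : Matrices N) where

    project : Vn → BI N → Carrier
    project x (i , t) = sumF (ns i) (λ j → x (i , j) * A i t j)

    embed : (BI N → Carrier) → Vn
    embed u (i , j) = sumF (N i) (λ t → u (i , t) * A i t j)

    project-lincomb : ∀ {d} c (v : Fin d → Vn) → project (lincomb d c v) ≗ lincomb d c (project ∘ v)
    project-lincomb c v (i , t) = sym (sumF-comm-* c (λ s j → v s (i , j)) (A i t))

    embed-lincomb : ∀ {d} c (v : Fin d → BI N → Carrier) → embed (lincomb d c v) ≗ lincomb d c (embed ∘ v)
    embed-lincomb c v (i , j) = sym (sumF-comm-* c (λ s t → v s (i , t)) (λ t → A i t j))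

    embed-cong : ∀ {u v} → u ≗ v → embed u ≗ embed v
    embed-cong u≗v (i , j) = sumF-cong (λ t → cong (_* A i t j) (u≗v (i , t)))

    project-cong : ∀ {x y} → x ≗ y → project x ≗ project y
    project-cong x≗y (i , t) = sumF-cong (λ j → cong (_* A i t j) (x≗y (i , j)))

    project-embed-adjoint : ∀ x u → dotB ns x (embed u) ≡ dotB N (project x) u
    project-embed-adjoint x u = sumF-cong λ i → trans
      (sumF-cong (λ j → cong (x (i , j) *_) (sumF-cong (λ t → *-comm (u (i , t)) (A i t j)))))
      (sumF-comm-* (λ j → x (i , j)) (λ j t → A i t j) (λ t → u (i , t)))

  -- Coordinates over K_i and the description of V_𝓛

  module _ (i : Fin ℓ) where

    coords : Carrier → Fin (ms i) → Carrier
    coords x = proj₁ (proj₂ (proj₂ (γ-basis i)) (λ _ → x) tt)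

    coords∈K : ∀ x r → Ks i (coords x r)
    coords∈K x = proj₁ (proj₂ (proj₂ (proj₂ (γ-basis i)) (λ _ → x) tt))

    coords-expand : ∀ x → x ≡ sumF (ms i) (λ r → coords x r * γ i r)
    coords-expand x = proj₂ (proj₂ (proj₂ (proj₂ (γ-basis i)) (λ _ → x) tt)) tt

    γ-independent : ∀ c → (∀ r → Ks i (c r)) → sumF (ms i) (λ r → c r * γ i r) ≡ 0# → ∀ r → c r ≡ 0#
    γ-independent c c∈K eq = proj₁ (proj₂ (γ-basis i)) c c∈K (λ _ → eq)

  module _ (𝓛 : SubTuple) where

    -- Row `r` of the coordinate matrix of uA: the entries of A lie in K_i, so taking coordinates
    -- commutes with multiplication by A.
    coordRow : (BI (N 𝓛) → Carrier) → (i : Fin ℓ) → Fin (ms i) → Fin (ns i) → Carrier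
    coordRow u i r = lincomb (N 𝓛 i) (λ t → coords i (u (i , t)) r) (A 𝓛 i)

    coordRow∈K : ∀ u i r j → Ks i (coordRow u i r j)
    coordRow∈K u i r j = sumF-closed (subfield i)
      (λ t → IsSubfield.*∈ (subfield i) (coords∈K i (u (i , t)) r) (A∈K 𝓛 i t j))

    embed-coordRow : ∀ u i j → embed (A 𝓛) u (i , j) ≡ sumF (ms i) (λ r → coordRow u i r j * γ i r)
    embed-coordRow u i j = begin
      sumF (N 𝓛 i) (λ t → u (i , t) * A 𝓛 i t j)
        ≡⟨ sumF-cong (λ t → trans (*-comm (u (i , t)) (A 𝓛 i t j)) (cong (A 𝓛 i t j *_) (coords-expand i (u (i , t))))) ⟩
      sumF (N 𝓛 i) (λ t → A 𝓛 i t j * sumF (ms i) (λ r → coords i (u (i , t)) r * γ i r))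
        ≡⟨ sumF-comm-* (λ t → A 𝓛 i t j) (λ t → coords i (u (i , t))) (γ i) ⟩
      sumF (ms i) (λ r → sumF (N 𝓛 i) (λ t → A 𝓛 i t j * coords i (u (i , t)) r) * γ i r)
        ≡⟨ sumF-cong (λ r → cong (_* γ i r) (sumF-cong (λ t → *-comm (A 𝓛 i t j) (coords i (u (i , t)) r)))) ⟩
      sumF (ms i) (λ r → coordRow u i r j * γ i r) ∎
      where open ≡-Reasoning

    embed∈V : ∀ {c} u → c ≗ embed (A 𝓛) u → V 𝓛 c
    embed∈V u c≗ i = coordRow u i
      , (coordRow∈K u i , λ j → trans (c≗ (i , j)) (embed-coordRow u i j))
      , λ r → coordRow∈K u i r , (λ t → coords i (u (i , t)) r) , (λ t → coords∈K i (u (i , t)) r) , λ j → refl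

    V⇒embed : ∀ {c} → V 𝓛 c → ∃[ u ] c ≗ embed (A 𝓛) u
    V⇒embed {c} c∈V = u , c≗
      where
      open ≡-Reasoning
      b : ∀ i → Fin (ms i) → Fin (N 𝓛 i) → Carrier
      b i r = proj₁ (proj₂ (proj₂ (proj₂ (c∈V i)) r))
      u : BI (N 𝓛) → Carrier
      -- Row `r` of the coordinate matrix of `c` is `b i r` times A. Weighting the rows by `γ i r`
      -- recovers `c`, and the same weighting of the `b i r` gives `u`.
      u (i , t) = sumF (ms i) (λ r → γ i r * b i r t)
      c≗ : c ≗ embed (A 𝓛) u
      c≗ (i , j) = let (a , (_ , eq) , rows) = c∈V i in begin
        c (i , j)
          ≡⟨ eq j ⟩
        sumF (ms i) (λ r → a r j * γ i r)
          ≡⟨ sumF-cong (λ r → trans (*-comm (a r j) (γ i r)) (cong (γ i r *_) (proj₂ (proj₂ (proj₂ (rows r))) j))) ⟩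
        sumF (ms i) (λ r → γ i r * sumF (N 𝓛 i) (λ t → b i r t * A 𝓛 i t j))
          ≡⟨ sumF-comm-* (γ i) (b i) (λ t → A 𝓛 i t j) ⟩
        embed (A 𝓛) u (i , j) ∎

    -- Independence over K_i of rows with entries in K_i persists over 𝔽: expand the coefficients in γ i.
    embed-injective : ∀ u → embed (A 𝓛) u ≗ 0v → u ≗ 0v
    embed-injective u eq (i , t) = trans (coords-expand i (u (i , t)))
      (sumF-zero (ms i) (λ r → trans (cong (_* γ i r) (coord≡0 r)) (zeroˡ _)))
      where
      coord≡0 : ∀ r → coords i (u (i , t)) r ≡ 0#
      coord≡0 r = A-indep 𝓛 i (λ t′ → coords i (u (i , t′)) r) (λ t′ → coords∈K i (u (i , t′)) r)
        (λ j → γ-independent i (λ r′ → coordRow u i r′ j) (λ r′ → coordRow∈K u i r′ j)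
                 (trans (sym (embed-coordRow u i j)) (eq (i , j))) r) t

  -- The dual code, and rank and nullity by elimination

  𝒞 : Vn → Set
  𝒞 = Span G

  open Code 𝒞

  module G = Annihilators (annihilatorsB ns G)

  -- A parity-check matrix: its rows form a basis of the dual code.
  H : Fin G.null → Vn
  H = G.K

  H⊥𝒞 : ∀ t → Dual (H t)
  H⊥𝒞 t c c∈𝒞 = dotB-span-zero ns (λ i → trans (dotB-comm ns (H t) (G i)) (G.M⊥K i t)) c∈𝒞

  Dual⇒∈H : ∀ {x} → Dual x → Span H x
  Dual⇒∈H {x} x∈Dual = G.⊥R⇒∈K x (λ t → trans (dotB-comm ns (G.R t) x) (x∈Dual (G.R t) (G.R⊆M t)))

  ∈H⇒Dual : ∀ {x} → Span H x → Dual x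
  ∈H⇒Dual {x} x∈H c c∈𝒞 = trans (dotB-comm ns x c)
    (dotB-span-zero ns (λ t → trans (dotB-comm ns c (H t)) (H⊥𝒞 t c c∈𝒞)) x∈H)

  ⊥H⇒∈𝒞 : ∀ {c} → (∀ t → dotB ns (H t) c ≡ 0#) → 𝒞 c
  ⊥H⇒∈𝒞 {c} H⊥c = span-trans G.R⊆M (G.⊥K⇒∈R c (λ t → trans (dotB-comm ns c (H t)) (H⊥c t)))

  -- The row space of the eliminated matrix is the projection of the dual code. Its `rank` realises
  -- ρ, and its kernel consists of those u with uA in 𝒞.
  module Projected {N : Fin ℓ → ℕ} (A : Matrices N) =
    Annihilators (annihilatorsB N (λ t → project A (H t)))

  module _ {N : Fin ℓ → ℕ} (A : Matrices N) where
    private module P = Projected A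

    projected-dual∈R : ∀ t → Span P.R (project A (H t))
    projected-dual∈R t = P.⊥K⇒∈R _ (P.M⊥K t)

    R⇒projected : ∀ t → ∃[ x ] (Dual x × (P.R t ≗ project A x))
    R⇒projected t = let (c , _ , eq) = P.R⊆M t in
      lincomb _ c H , ∈H⇒Dual (c , _ , λ _ → refl) ,
      λ ι → trans (eq ι) (sym (project-lincomb A c H ι))

    Dual⇒project∈R : ∀ {x} → Dual x → Span P.R (project A x)
    Dual⇒project∈R x∈ = let (c , _ , eq) = Dual⇒∈H x∈ in
      span-trans projected-dual∈R (c , _ , λ ι →
        trans (project-cong A eq ι) (project-lincomb A c H ι))

    embed∈𝒞⇒∈K : ∀ u → 𝒞 (embed A u) → Span P.K u
    embed∈𝒞⇒∈K u uA∈𝒞 = P.⊥R⇒∈K u (λ t → trans (dotB-comm N (P.R t) u)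
      (dotB-span-zero N (λ s → trans (dotB-comm N u (project A (H s)))
        (trans (sym (project-embed-adjoint A (H s) u)) (H⊥𝒞 s _ uA∈𝒞))) (P.R⊆M t)))

    embed-K∈𝒞 : ∀ t → 𝒞 (embed A (P.K t))
    embed-K∈𝒞 t = ⊥H⇒∈𝒞 (λ s → trans (project-embed-adjoint A (H s) (P.K t)) (P.M⊥K s t))

    -- Selecting rows of A selects columns of the matrix of projected parity checks, and the
    -- restrictions of `P.R` to these columns still span its rows.
    rank-restrict : ∀ {N′} (A′ : Matrices N′) (φ : ∀ i → Fin (N′ i) → Fin (N i)) →
      (∀ i t → A′ i t ≗ A i (φ i t)) → Projected.rank A′ ≤ P.rank
    rank-restrict {N′} A′ φ A′≗A = steinitz {v = λ t → P.R t ∘ φ̂} (Projected.R-independent A′)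
      (λ t → span-trans H-restrict (Projected.R⊆M A′ t))
      where
      φ̂ : BI N′ → BI N
      φ̂ (i , t) = i , φ i t
      H-restrict : ∀ s → Span (λ t → P.R t ∘ φ̂) (project A′ (H s))
      H-restrict s = let (c , _ , eq) = projected-dual∈R s in c , _ , λ { (i , t) →
        trans (sumF-cong (λ j → cong (H s (i , j) *_) (A′≗A i t j))) (eq (i , φ i t)) }

  ρ-rank : ∀ 𝓛 → ρ 𝓛 (Projected.rank (A 𝓛))
  ρ-rank 𝓛 = P.R , R⇒projected (A 𝓛) , P.R-independent ,
    λ { y (x , x∈ , y≗) → span-resp (λ ι → sym (y≗ ι)) (Dual⇒project∈R (A 𝓛) x∈) }
    where module P = Projected (A 𝓛)

  dim-null : ∀ 𝓛 → HasDim AllF (λ c → 𝒞 c × V 𝓛 c) (Projected.null (A 𝓛))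
  dim-null 𝓛 = (λ t → embed (A 𝓛) (P.K t))
    , (λ t → embed-K∈𝒞 (A 𝓛) t , embed∈V 𝓛 (P.K t) (λ _ → refl))
    , (λ c _ eq → P.K-independent c _ (embed-injective 𝓛 (lincomb _ c P.K)
        (λ ι → trans (embed-lincomb (A 𝓛) c P.K ι) (eq ι))))
    , λ { x (x∈𝒞 , x∈V) →
        let (u , x≗) = V⇒embed 𝓛 x∈V
            (c , _ , eq) = embed∈𝒞⇒∈K (A 𝓛) u (span-resp x≗ x∈𝒞)
        in c , _ , λ ι → trans (x≗ ι) (trans (embed-cong (A 𝓛) eq ι) (embed-lincomb (A 𝓛) c P.K ι)) }
    where module P = Projected (A 𝓛)

  -- The full tuple and the removal of rows

  fullTuple : SubTuple
  fullTuple = record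
    { N = ns
    ; A = λ i → δ
    ; A∈K = λ i t j → δ∈K i t j
    ; A-indep = λ i c _ eq t → trans (sym (sumF-δʳ t c)) (eq t) }
    where
    δ∈K : ∀ i {n} (t j : Fin n) → Ks i (δ t j)
    δ∈K i zero    zero    = IsSubfield.1∈ (subfield i)
    δ∈K i zero    (suc j) = IsSubfield.0∈ (subfield i)
    δ∈K i (suc t) zero    = IsSubfield.0∈ (subfield i)
    δ∈K i (suc t) (suc j) = δ∈K i t j

  -- For identity matrices V_𝓛 is the whole space, so 𝒞 itself lies in 𝒞 ∩ V_𝓛. This guarantees that
  -- the search for a minimum has a witness.
  k≤null-full : Independent AllF G → k ≤ Projected.null (A fullTuple)
  k≤null-full G-indep = let (w , _ , _ , spans) = dim-null fullTuple in
    steinitz G-indep (λ t → spans (G t)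
      (span-generator G t , embed∈V fullTuple (G t) (λ { (i , j) → sym (sumF-δʳ j (λ t′ → G t (i , t′))) })))

  -- Rank and nullity add up to the number of rows and the rank does not grow under restriction, so
  -- the nullity drops by at most the number `d` of lost rows. The case `d` = 1 deletes a row; `d` =
  -- 0 shows that the nullity respects pointwise equality.
  null-restrict : ∀ {N N′} (A : Matrices N) (A′ : Matrices N′) (φ : ∀ i → Fin (N′ i) → Fin (N i)) →
    (∀ i t → A′ i t ≗ A i (φ i t)) → ∀ d → Σℕ ℓ N ≡ d ℕ.+ Σℕ ℓ N′ → Projected.null A ≤ d ℕ.+ Projected.null A′
  null-restrict {N} {N′} A A′ φ A′≗A d ΣN≡ = ℕ.+-cancelˡ-≤ (Projected.rank A) _ _ (begin
    Projected.rank A ℕ.+ Projected.null A             ≡⟨ trans (Projected.rank+null A) ΣN≡ ⟩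
    d ℕ.+ Σℕ ℓ N′                       ≡⟨ cong (d ℕ.+_) (Projected.rank+null A′) ⟨
    d ℕ.+ (Projected.rank A′ ℕ.+ Projected.null A′)   ≤⟨ ℕ.+-monoʳ-≤ d (ℕ.+-monoˡ-≤ (Projected.null A′) (rank-restrict A A′ φ A′≗A)) ⟩
    d ℕ.+ (Projected.rank A ℕ.+ Projected.null A′)    ≡⟨ swap d (Projected.rank A) (Projected.null A′) ⟩
    Projected.rank A ℕ.+ (d ℕ.+ Projected.null A′)    ∎)
    where
    open ℕ.≤-Reasoning
    swap : ∀ a b c → a ℕ.+ (b ℕ.+ c) ≡ b ℕ.+ (a ℕ.+ c)
    swap a b c = trans (sym (ℕ.+-assoc a b c)) (trans (cong (ℕ._+ c) (ℕ.+-comm a b)) (ℕ.+-assoc b a c))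

  drop-generator : ∀ i {n n′} → n ≡ n′ ⊎ n ≡ suc n′ → (B : Fin n → Fin (ns i) → Carrier) →
    Independent (Ks i) B → ∃[ φ ] Independent (Ks i) {n′} (B ∘ φ)
  drop-generator i (inj₁ refl) B ind = id , ind
  drop-generator i (inj₂ refl) B ind = suc , λ c c∈K eq t →
    ind (0# ∷ c) (λ { zero → IsSubfield.0∈ (subfield i) ; (suc t) → c∈K t })
      (λ j → trans (x≡0⇒x+y≡y _ (zeroˡ _)) (eq j)) (suc t)

  drop-row : ∀ 𝓛 {m} → Rk 𝓛 ≡ suc m → ∃[ 𝓛′ ] (Rk 𝓛′ ≡ m × Projected.null (A 𝓛) ≤ suc (Projected.null (A 𝓛′)))
  drop-row 𝓛 Rk≡ = 𝓛′ , ΣN′≡m ,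
    null-restrict (A 𝓛) (A 𝓛′) (λ i → proj₁ (dropped i)) (λ i t j → refl) 1 (trans Rk≡ (cong suc (sym ΣN′≡m)))
    where
    decremented = Σℕ-decrement ℓ (N 𝓛) Rk≡
    N′ = proj₁ decremented
    ΣN′≡m = proj₁ (proj₂ decremented)
    dropped : ∀ i → ∃[ φ ] Independent (Ks i) {N′ i} (A 𝓛 i ∘ φ)
    dropped i = drop-generator i (proj₂ (proj₂ decremented) i) (A 𝓛 i) (A-indep 𝓛 i)
    𝓛′ : SubTuple
    𝓛′ = record
      { N = N′
      ; A = λ i → A 𝓛 i ∘ proj₁ (dropped i)
      ; A∈K = λ i t → A∈K 𝓛 i (proj₁ (dropped i) t)
      ; A-indep = λ i → proj₂ (dropped i) }

  -- Decidability of K_i and the search over tuples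

  -- Both sides are coordinates over K_i of the same element `x`, so their difference expands 0 and
  -- vanishes by independence of `γ i`.
  coords-linear : ∀ i {x} → Ks i x → ∀ r → coords i x r ≡ x * coords i 1# r
  coords-linear i {x} x∈K r = trans (sym (x+[y-x]≡y (x * coords i 1# r) _))
    (trans (cong (x * coords i 1# r +_) (γ-independent i difference difference∈K vanishes r)) (+-identityʳ _))
    where
    difference : Fin (ms i) → Carrier
    difference r = coords i x r + - (x * coords i 1# r)
    difference∈K : ∀ r → Ks i (difference r)
    difference∈K r = let open IsSubfield (subfield i) in
      +∈ (coords∈K i x r) (-∈ (*∈ x∈K (coords∈K i 1# r)))
    open ≡-Reasoning
    vanishes : dotF difference (γ i) ≡ 0#
    vanishes = begin
      dotF difference (γ i)
        ≡⟨ dotF-subˡ (coords i x) x (coords i 1#) (γ i) ⟩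
      x * - dotF (coords i 1#) (γ i) + dotF (coords i x) (γ i)
        ≡⟨ cong₂ (λ y z → x * - y + z) (coords-expand i 1#) (coords-expand i x) ⟨
      x * - 1# + x
        ≡⟨ cong (_+ x) (trans (sym (-‿distribʳ-* x 1#)) (cong -_ (*-identityʳ x))) ⟩
      - x + x
        ≡⟨ -‿inverseˡ x ⟩
      0# ∎

  -- By linearity, x ∈ K_i is determined by comparing the coordinates of x and 1
  -- at a position where the latter does not vanish.
  K? : ∀ i x → Dec (Ks i x)
  K? i x with any? (λ r → ¬? (coords i 1# r ≟ 0#))
  ... | no all0 = contradiction (sym (trans (coords-expand i 1#) (sumF-zero (ms i) λ r →
          trans (cong (_* γ i r) (decidable-stable (_ ≟ _) (λ ≢0 → all0 (r , ≢0)))) (zeroˡ _)))) 0≢1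
  ... | yes (r , c≢0) = map′
      (λ eq → subst (Ks i) (sym eq) (*∈ (coords∈K i x r) (⁻¹∈ (coords∈K i 1# r) c*y≡1)))
      (λ x∈K → sym (trans (cong (_* y) (coords-linear i x∈K r))
        (trans (*-assoc x _ y) (trans (cong (x *_) c*y≡1) (*-identityʳ x)))))
      (x ≟ (coords i x r * y))
    where
    open IsSubfield (subfield i)
    y = proj₁ (inverse _ c≢0)
    c*y≡1 = proj₂ (inverse _ c≢0)

  search-Carrier : Searchable Carrier _≡_ Unbounded
  search-Carrier P _ P? = map′
    (λ any → let (x , _ , p) = find any in x , tt , p)
    (λ { (x , _ , p) → lose (complete x) p })
    (anyElement? P? elements)

  search-vector : ∀ n → Searchable (Fin n → Carrier) _≗_ (λ _ → ∀ i → ⊤)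
  search-vector n = search-Π n (λ _ → refl) (λ _ → search-Carrier)

  -- Searches the finitely many coefficient vectors for a nontrivial relation over K_i; `K?` makes
  -- the test on each of them decidable.
  independent? : ∀ i {n m} (B : Fin n → Fin m → Carrier) → Dec (Independent (Ks i) B)
  independent? i {n} B = map′
    (λ none c c∈K eq → decidable-stable (all? (λ t → c t ≟ 0#))
      (λ c≢0 → none (c , _ , c∈K , eq , c≢0)))
    (λ { ind (c , _ , c∈K , eq , c≢0) → c≢0 (ind c c∈K eq) })
    (¬? (search-vector n Relation resp relation?))
    where
    Relation : (Fin n → Carrier) → Set
    Relation c = (∀ t → Ks i (c t)) × (lincomb n c B ≗ 0v) × ¬ (∀ t → c t ≡ 0#)
    resp : ∀ {c c′} → c ≗ c′ → Relation c → Relation c′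
    resp c≗c′ (c∈K , eq , c≢0) =
      (λ t → subst (Ks i) (c≗c′ t) (c∈K t)) ,
      (λ j → trans (sumF-cong (λ t → cong (_* B t j) (sym (c≗c′ t)))) (eq j)) ,
      (λ c′≡0 → c≢0 (λ t → trans (c≗c′ t) (c′≡0 t)))
    relation? : ∀ c → Dec (Relation c)
    relation? c = all? (λ t → K? i (c t)) ×-dec all? (λ j → lincomb n c B j ≟ 0#) ×-dec ¬? (all? (λ t → c t ≟ 0#))

  Block : Fin ℓ → Set
  Block i = Σ ℕ (λ n → Fin n → Fin (ns i) → Carrier)

  -- Inductive, so that matching identifies the two row counts and the rows can be compared without
  -- transport.
  data _≈_ {i} : Block i → Block i → Set where
    pointwise : ∀ {n B C} → (∀ t → B t ≗ C t) → (n , B) ≈ (n , C)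

  ≈-refl : ∀ {i} (b : Block i) → b ≈ b
  ≈-refl b = pointwise (λ _ _ → refl)

  search-Block : ∀ r i → Searchable (Block i) _≈_ (λ b → proj₁ b ≤ r)
  search-Block r i P resp P? = map′
    (λ { (n , s≤s n≤r , B , _ , p) → (n , B) , n≤r , p })
    (λ { ((n , B) , n≤r , p) → n , s≤s n≤r , B , _ , p })
    (ℕ.anyUpTo? (λ n → search-Π n (λ _ _ → refl) (λ _ → search-vector (ns i))
      (λ B → P (n , B)) (resp ∘ pointwise) (λ B → P? (n , B))) (suc r))

  Valid : ∀ i → Block i → Set
  Valid i (n , B) = (∀ t j → Ks i (B t j)) × Independent (Ks i) B

  valid? : ∀ i b → Dec (Valid i b)
  valid? i (n , B) = all? (λ t → all? (λ j → K? i (B t j))) ×-dec independent? i B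

  Valid-resp : ∀ {i b c} → b ≈ c → Valid i b → Valid i c
  Valid-resp {i} (pointwise B≗C) (B∈K , ind) =
    (λ t j → subst (Ks i) (B≗C t j) (B∈K t j)) ,
    λ c c∈K eq → ind c c∈K (λ j → trans (lincomb-cong c B≗C j) (eq j))

  ≈⇒size≡ : ∀ {i} {b c : Block i} → b ≈ c → proj₁ b ≡ proj₁ c
  ≈⇒size≡ (pointwise _) = refl

  ≈⇒rows : ∀ {i} {b c : Block i} → b ≈ c →
    Σ (Fin (proj₁ c) → Fin (proj₁ b)) (λ φ → ∀ t → proj₂ c t ≗ proj₂ b (φ t))
  ≈⇒rows (pointwise B≗C) = id , λ t j → sym (B≗C t j)

  -- The common minimum

  -- The condition minimised in `dSR`, with the dimension replaced by its computed value. The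
  -- inequality, rather than the equality of `dS`, is what lets the full tuple serve as a first
  -- witness.
  Attains : ℕ → ℕ → Set
  Attains w r = ∃[ 𝓛 ] (Rk 𝓛 ≡ r × w ≤ Projected.null (A 𝓛))

  attains? : ∀ w r → Dec (Attains w r)
  attains? w r = map′
    (λ { (b , _ , valid , Σ≡r , w≤) → record
      { N = proj₁ ∘ b ; A = λ i → proj₂ (b i)
      ; A∈K = λ i → proj₁ (valid i) ; A-indep = λ i → proj₂ (valid i) } , Σ≡r , w≤ })
    -- No block has more rows than the total `r`, which makes the search space finite.
    (λ { (𝓛 , Rk≡r , w≤) → (λ i → N 𝓛 i , A 𝓛 i) , (λ i → subst (N 𝓛 i ≤_) Rk≡r (≤Σℕ (N 𝓛) i)) ,
      (λ i → A∈K 𝓛 i , A-indep 𝓛 i) , Rk≡r , w≤ })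
    (search-Π ℓ ≈-refl (search-Block r) Good resp good?)
    where
    Good : (∀ i → Block i) → Set
    Good b = (∀ i → Valid i (b i)) × Σℕ ℓ (proj₁ ∘ b) ≡ r × w ≤ Projected.null (λ i → proj₂ (b i))
    good? : ∀ b → Dec (Good b)
    good? b = all? (λ i → valid? i (b i)) ×-dec (Σℕ ℓ (proj₁ ∘ b) ℕ.≟ r) ×-dec (w ℕ.≤? Projected.null (λ i → proj₂ (b i)))
    resp : ∀ {b c} → (∀ i → b i ≈ c i) → Good b → Good c
    resp {b} {c} b≈c (valid , Σ≡r , w≤) =
      (λ i → Valid-resp (b≈c i) (valid i)) ,
      trans (sym (Σℕ-cong ℓ (λ i → ≈⇒size≡ (b≈c i)))) Σ≡r ,
      ℕ.≤-trans w≤ (null-restrict (λ i → proj₂ (b i)) (λ i → proj₂ (c i)) (λ i → proj₁ (≈⇒rows (b≈c i))) (λ i → proj₂ (≈⇒rows (b≈c i)))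
        0 (Σℕ-cong ℓ (λ i → ≈⇒size≡ (b≈c i))))

  null≡Rk∸rank : ∀ 𝓛 → Rk 𝓛 ℕ.∸ Projected.rank (A 𝓛) ≡ Projected.null (A 𝓛)
  null≡Rk∸rank 𝓛 = trans (cong (ℕ._∸ Projected.rank (A 𝓛)) (sym (Projected.rank+null (A 𝓛)))) (ℕ.m+n∸m≡n (Projected.rank (A 𝓛)) _)

  -- Dropping a row would otherwise give a smaller tuple still of nullity at least w.
  minimal-null : ∀ {w r} 𝓛 → Rk 𝓛 ≡ r → w ≤ Projected.null (A 𝓛) → (∀ r′ → Attains w r′ → r ≤ r′) → Projected.null (A 𝓛) ≡ w
  minimal-null {w} {r} 𝓛 Rk≡r w≤ min with ℕ.m≤n⇒m<n∨m≡n w≤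
  ... | inj₂ eq = sym eq
  ... | inj₁ w<null with r
  ...   | zero = contradiction (ℕ.≤-trans w<null
            (ℕ.≤-trans (ℕ.m≤n+m _ (Projected.rank (A 𝓛))) (ℕ.≤-reflexive (trans (Projected.rank+null (A 𝓛)) Rk≡r)))) (λ ())
  ...   | suc m = let (𝓛′ , Rk′≡m , null≤) = drop-row 𝓛 Rk≡r in
            contradiction (min m (𝓛′ , Rk′≡m , ℕ.≤-pred (ℕ.≤-trans w<null null≤))) ℕ.1+n≰n

  generalized-weights-agree : Independent AllF G → ∀ w → w ≤ k → ∃[ m ] (dS ρ w m × dSR w m)
  generalized-weights-agree G-indep w w≤k =
    let (m , (𝓛 , Rk≡m , w≤null) , min) =
          least (attains? w) (Rk fullTuple) (fullTuple , refl , ℕ.≤-trans w≤k (k≤null-full G-indep))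
        null≡w = minimal-null 𝓛 Rk≡m w≤null min
    in m
     , ((𝓛 , (Projected.rank (A 𝓛) , ρ-rank 𝓛 , trans (null≡Rk∸rank 𝓛) null≡w) , Rk≡m)
       -- Here `ρ′` is the size of some basis of the projected dual, hence at least the computed
       -- rank. Truncated subtraction is antitone in its second argument, so `w` is at most the
       -- computed nullity.
       , λ { r (𝓛′ , (ρ′ , hasRank , Rk∸ρ′≡w) , Rk≡r) → min r (𝓛′ , Rk≡r ,
             subst₂ _≤_ Rk∸ρ′≡w (null≡Rk∸rank 𝓛′) (ℕ.∸-monoʳ-≤ (Rk 𝓛′) (basis-size≤ (ρ-rank 𝓛′) hasRank))) })
     , ((𝓛 , Rk≡m , Projected.null (A 𝓛) , dim-null 𝓛 , w≤null)
       -- Likewise `d` is the size of some basis of 𝒞 ∩ V_𝓛′, hence at most the computed nullity.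
       , λ { r (𝓛′ , Rk≡r , d , hasDim , w≤d) → min r (𝓛′ , Rk≡r ,
             ℕ.≤-trans w≤d (basis-size≤ hasDim (dim-null 𝓛′))) })

theorem41 : (𝔽 : FiniteField) (ℓ : ℕ) (ns : Fin ℓ → ℕ)
    (Ks : Fin ℓ → FiniteField.Carrier 𝔽 → Set) (ms : Fin ℓ → ℕ)
    (γ : (i : Fin ℓ) → Fin (ms i) → FiniteField.Carrier 𝔽) →
    let open SumRank 𝔽 ℓ ns Ks ms γ in
    1 ≤ ℓ → (∀ i → 1 ≤ ns i) →
    (∀ i → IsSubfield (Ks i)) →
    (∀ i → IsBasis {I = ⊤} (Ks i) (λ _ → ⊤) (λ r _ → γ i r)) →
    (k : ℕ) (G : Fin k → Vn) → Independent AllF G →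
    let 𝒞 = InSpan AllF G in
    (∀ i → 1 ≤ i → i ≤ k → ∃[ m ] (dS (Code.ρ 𝒞) i m × Code.dSR 𝒞 i m))
theorem41 𝔽 ℓ ns Ks ms γ _ _ subfield γ-basis k G G-indep i _ i≤k =
  SumRankCode.generalized-weights-agree 𝔽 ℓ ns Ks ms γ subfield γ-basis k G G-indep i i≤k
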